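{- For every $\beta > 0$ there exist $N=N(\beta)$ and $\delta=\delta(\beta)>0$ such that every graph $G$ with $n > N$ vertices and $m \ge \beta n^2$ edges satisfying $\tau_t(G) \ge (1-\delta)\frac{m}{2}$ also satisfies $$\tau_t^*(G) \ge \left(1+\frac{\beta^2}{800}\right)\frac{m}{4}.$$
   Context: All graphs are finite, simple and undirected. $\tau_t(G)$ is the minimum number of edges of $G$ whose removal leaves a triangle-free graph. A fractional triangle cover of $G$ is a function $f:E(G)\to[0,\infty)$ such that for every triangle of $G$ the sum of $f$ over its three edges is at least $1$; $\tau_t^*(G)$ is the minimum of $\sum_{e\in E(G)} f(e)$ over all fractional triangle covers $f$.
   Formalization: The parameter β ranges over positive rational numbers rather than positive reals; fractional triangle covers take rational values, which does not change the bound on τ*_t, and δ is found rational. -}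

module Defs where

open import Data.Nat as ℕ using (ℕ; zero; suc)
open import Data.Fin using (Fin; zero; suc; toℕ)
open import Data.Bool using (Bool; true; false; if_then_else_; _∧_; not)
open import Data.Integer using (+_)
open import Data.Rational as ℚ using (ℚ; 0ℚ; 1ℚ; _≤_; _+_; _*_)
open import Relation.Binary.PropositionalEquality using (_≡_)
open import Relation.Nullary.Decidable using (⌊_⌋)
open import Data.Product using (_×_)
open import Data.Empty using (⊥)

record Graph (n : ℕ) : Set where
  field
    adj    : Fin n → Fin n → Bool
    sym    : ∀ i j → adj i j ≡ adj j i
    irrefl : ∀ i → adj i i ≡ false
open Graph public

sumFin : {A : Set} → (zeroA : A) → (_⊕_ : A → A → A) → (n : ℕ) → (Fin n → A) → A
sumFin z _⊕_ zero    f = z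
sumFin z _⊕_ (suc n) f = f zero ⊕ sumFin z _⊕_ n (λ i → f (suc i))

_<ᵇ_ : {n : ℕ} → Fin n → Fin n → Bool
i <ᵇ j = ⌊ toℕ i ℕ.<? toℕ j ⌋

isEdge : {n : ℕ} → Graph n → Fin n → Fin n → Bool
isEdge G i j = (i <ᵇ j) ∧ adj G i j

edgeCount : {n : ℕ} → Graph n → ℕ
edgeCount {n} G = sumFin 0 ℕ._+_ n λ i → sumFin 0 ℕ._+_ n λ j →
  if isEdge G i j then 1 else 0

-- An edge set F ⊆ E(G), given as a Boolean function on pairs i<j
-- (values off edges are ignored). Its size:
edgeSetSize : {n : ℕ} → Graph n → (Fin n → Fin n → Bool) → ℕ
edgeSetSize {n} G F = sumFin 0 ℕ._+_ n λ i → sumFin 0 ℕ._+_ n λ j →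
  if isEdge G i j ∧ F i j then 1 else 0

IsTriangle : {n : ℕ} → Graph n → Fin n → Fin n → Fin n → Set
IsTriangle G i j k =
  (isEdge G i j ≡ true) × (isEdge G j k ≡ true) × (isEdge G i k ≡ true)

TriangleFreeAfterRemoval : {n : ℕ} → Graph n → (Fin n → Fin n → Bool) → Set
TriangleFreeAfterRemoval G F =
  ∀ i j k → IsTriangle G i j k →
    (not (F i j) ∧ not (F j k) ∧ not (F i k)) ≡ true → ⊥

-- τ_t(G) ≥ q : every edge set whose removal leaves a triangle-free graph
-- has at least q edges (i.e. the minimum τ_t(G) is ≥ q).
τt≥ : {n : ℕ} → Graph n → ℚ → Set
τt≥ G q = ∀ F → TriangleFreeAfterRemoval G F → q ≤ (+ edgeSetSize G F ℚ./ 1)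

-- Fractional triangle covers: weights f on edges {i,j}, i<j, read at f i j.
IsFractionalTriangleCover : {n : ℕ} → Graph n → (Fin n → Fin n → ℚ) → Set
IsFractionalTriangleCover G f =
  (∀ i j → isEdge G i j ≡ true → 0ℚ ≤ f i j) ×
  (∀ i j k → IsTriangle G i j k → 1ℚ ≤ (f i j + f j k) + f i k)

weight : {n : ℕ} → Graph n → (Fin n → Fin n → ℚ) → ℚ
weight {n} G f = sumFin 0ℚ _+_ n λ i → sumFin 0ℚ _+_ n λ j →
  if isEdge G i j then f i j else 0ℚ

τt*≥ : {n : ℕ} → Graph n → ℚ → Set
τt*≥ G q = ∀ f → IsFractionalTriangleCover G f → q ≤ weight G f

{-# OPTIONS --safe #-}
-- Let f be a fractional cover of weight w. For a level θ ≤ 1/3, every triangle containing an edge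
-- with f ≤ θ also contains one with f ≥ (1 - θ)/2; so removing all edges of the latter kind, and the
-- edges of intermediate value left uncut by a random bipartition, destroys all triangles. Averaging
-- over θ ∈ [0, 1/3] removes at most 2w edges, with a loss that vanishes only for values of f near 0
-- and near 1/2. Hence, if τ is close to m/2 and w to m/4, almost all values of f are near 0 or 1/2:
-- about half of the edges are light (f ≤ 1/8) and very few are heavy (f ≥ 3/4). But two light edges
-- at a vertex v that lie in a triangle force its third edge to be heavy, so the light neighbourhood
-- of a vertex spans few edges, while on average it has Ω(βm) incident ones. A random bipartition
-- biased on such a neighbourhood cuts (1/2 + Ω(β²)) m edges, contradicting τ ≥ (1 - δ) m/2.
module Submission where

open import Defs
open import Data.Nat using (ℕ; _<_)
open import Data.Integer using (+_)
open import Data.Rational using (ℚ; 0ℚ; 1ℚ; _≤_; _+_; _*_; _-_; _/_)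
open import Data.Rational using () renaming (_<_ to _<ℚ_)
open import Data.Product using (Σ; _×_)

open import Data.Bool using (Bool; true; false; if_then_else_; _∧_; _∨_; not)
open import Data.Empty using (⊥; ⊥-elim)
open import Data.Fin using (Fin; zero; suc; toℕ)
import Data.Integer as ℤ
import Data.Integer.Properties as ℤₚ
open import Data.Nat using (zero; suc; z≤n; s≤s)
import Data.Nat as ℕ
open import Data.Nat.Coprimality using (1-coprimeTo)
import Data.Nat.Properties as ℕₚ
open import Data.Product using (_,_; proj₁; proj₂)
import Data.Rational as ℚ
open import Data.Rational using (½; -_; _≤?_; mkℚ; toℚᵘ; Positive; positive; nonNegative)
open import Data.Rational.Properties
import Data.Rational.Unnormalised as ℚᵘ
import Data.Rational.Unnormalised.Properties as ℚᵘₚ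
open import Data.Sum using (_⊎_; inj₁; inj₂; [_,_]′)
open import Function using (_∘_; id)
open import Relation.Binary.PropositionalEquality
  using (_≡_; refl; trans; cong; cong₂; subst)
  renaming (sym to ≡-sym)
open import Relation.Nullary using (¬_; Dec; yes; no)
open import Relation.Nullary.Decidable using (⌊_⌋; dec⇒maybe)
open import Tactic.RingSolver using (solve-∀)
open import Tactic.RingSolver.Core.AlmostCommutativeRing using (AlmostCommutativeRing; fromCommutativeRing)

-- Rational inequalities and finite sums

ℚ-ring : AlmostCommutativeRing _ _
ℚ-ring = fromCommutativeRing +-*-commutativeRing (λ x → dec⇒maybe (0ℚ ≟ x))

p≤q⇒0≤q-p : ∀ {p q} → p ≤ q → 0ℚ ≤ q - p
p≤q⇒0≤q-p {p} {q} p≤q = subst (_≤ q - p) (+-inverseʳ p) (+-monoˡ-≤ (- p) p≤q)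

-- The certificate form of every numerical estimate below: `d` is a nonnegative combination of the
-- hypotheses, and the ring solver checks that it equals `q - p`.
0≤d≡q-p⇒p≤q : ∀ {p q d} → 0ℚ ≤ d → d ≡ q - p → p ≤ q
0≤d≡q-p⇒p≤q {p} {q} 0≤d refl =
  subst (p ≤_) (restore p q) (subst (_≤ p + (q - p)) (+-identityʳ p) (+-monoʳ-≤ p 0≤d))
  where
  restore : ∀ p q → p + (q - p) ≡ q
  restore = solve-∀ ℚ-ring

≤-respʳ : ∀ {p q r} → q ≡ r → p ≤ q → p ≤ r
≤-respʳ refl p≤q = p≤q

≤-respˡ : ∀ {p q r} → p ≡ q → p ≤ r → q ≤ r
≤-respˡ refl p≤r = p≤r

+-nonneg : ∀ {p q} → 0ℚ ≤ p → 0ℚ ≤ q → 0ℚ ≤ p + q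
+-nonneg 0≤p 0≤q = +-mono-≤ 0≤p 0≤q

*-nonneg : ∀ {p q} → 0ℚ ≤ p → 0ℚ ≤ q → 0ℚ ≤ p * q
*-nonneg {p} {q} 0≤p 0≤q =
  subst (_≤ p * q) (*-zeroʳ p) (*-monoˡ-≤-nonNeg p {{nonNegative 0≤p}} 0≤q)

*-monoˡ : ∀ {c p q} → 0ℚ ≤ c → p ≤ q → c * p ≤ c * q
*-monoˡ {c} 0≤c p≤q = *-monoˡ-≤-nonNeg c {{nonNegative 0≤c}} p≤q

ι : Bool → ℚ
ι b = if b then 1ℚ else 0ℚ

0≤ι : ∀ b → 0ℚ ≤ ι b
0≤ι true  = nonNegative⁻¹ 1ℚ
0≤ι false = ≤-refl

κ : ℕ → ℚ
κ n = + n / 1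

κ-+ : ∀ a b → κ (a ℕ.+ b) ≡ κ a + κ b
κ-+ a b = toℚᵘ-injective (begin
  toℚᵘ (κ (a ℕ.+ b))                    ≈⟨ toℚᵘ-fromℚᵘ (mkℚᵘ (+ (a ℕ.+ b)) 0) ⟩
  mkℚᵘ (+ (a ℕ.+ b)) 0                  ≈⟨ *≡* (cong (λ z → z ℤ.* + 1) numerators) ⟩
  mkℚᵘ (+ a) 0 ℚᵘ.+ mkℚᵘ (+ b) 0        ≈⟨ ℚᵘₚ.+-cong (toℚᵘ-fromℚᵘ (mkℚᵘ (+ a) 0)) (toℚᵘ-fromℚᵘ (mkℚᵘ (+ b) 0)) ⟨
  toℚᵘ (κ a) ℚᵘ.+ toℚᵘ (κ b)            ≈⟨ toℚᵘ-homo-+ (κ a) (κ b) ⟨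
  toℚᵘ (κ a + κ b)                      ∎)
  where
  open ℚᵘₚ.≃-Reasoning
  open ℚᵘ using (mkℚᵘ; *≡*)
  numerators : + (a ℕ.+ b) ≡ + a ℤ.* + 1 ℤ.+ + b ℤ.* + 1
  numerators = ≡-sym (cong₂ ℤ._+_ (ℤₚ.*-identityʳ (+ a)) (ℤₚ.*-identityʳ (+ b)))

κ-suc : ∀ n → κ (suc n) ≡ 1ℚ + κ n
κ-suc n = κ-+ 1 n

∑ : ∀ n → (Fin n → ℚ) → ℚ
∑ = sumFin 0ℚ _+_

∑-cong : ∀ {n} {f g : Fin n → ℚ} → (∀ i → f i ≡ g i) → ∑ n f ≡ ∑ n g
∑-cong {zero}  f≡g = refl
∑-cong {suc n} f≡g = cong₂ _+_ (f≡g zero) (∑-cong (f≡g ∘ suc))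

∑-mono : ∀ {n} {f g : Fin n → ℚ} → (∀ i → f i ≤ g i) → ∑ n f ≤ ∑ n g
∑-mono {zero}  f≤g = ≤-refl
∑-mono {suc n} f≤g = +-mono-≤ (f≤g zero) (∑-mono (f≤g ∘ suc))

∑-nonneg : ∀ {n} {f : Fin n → ℚ} → (∀ i → 0ℚ ≤ f i) → 0ℚ ≤ ∑ n f
∑-nonneg {zero}  0≤f = ≤-refl
∑-nonneg {suc n} 0≤f = +-nonneg (0≤f zero) (∑-nonneg (0≤f ∘ suc))

∑-+ : ∀ {n} (f g : Fin n → ℚ) → ∑ n (λ i → f i + g i) ≡ ∑ n f + ∑ n g
∑-+ {zero}  f g = refl
∑-+ {suc n} f g =
  trans (cong (_+_ (f zero + g zero)) (∑-+ (f ∘ suc) (g ∘ suc)))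
        (interchange (f zero) (g zero) (∑ n (f ∘ suc)) (∑ n (g ∘ suc)))
  where
  interchange : ∀ a b c d → (a + b) + (c + d) ≡ (a + c) + (b + d)
  interchange = solve-∀ ℚ-ring

∑-* : ∀ {n} c (f : Fin n → ℚ) → ∑ n (λ i → c * f i) ≡ c * ∑ n f
∑-* {zero}  c f = ≡-sym (*-zeroʳ c)
∑-* {suc n} c f = trans (cong (_+_ (c * f zero)) (∑-* c (f ∘ suc)))
                        (≡-sym (*-distribˡ-+ c (f zero) (∑ n (f ∘ suc))))

∑-const : ∀ n c → ∑ n (λ _ → c) ≡ κ n * c
∑-const zero    c = ≡-sym (*-zeroˡ c)
∑-const (suc n) c = trans (cong (_+_ c) (∑-const n c))
                          (trans (factor c (κ n)) (cong (_* c) (≡-sym (κ-suc n))))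
  where
  factor : ∀ c k → c + k * c ≡ (1ℚ + k) * c
  factor = solve-∀ ℚ-ring

∑-swap : ∀ m n (f : Fin m → Fin n → ℚ) →
  ∑ m (λ i → ∑ n (f i)) ≡ ∑ n (λ j → ∑ m (λ i → f i j))
∑-swap zero    n f = ≡-sym (trans (∑-const n 0ℚ) (*-zeroʳ (κ n)))
∑-swap (suc m) n f =
  trans (cong (_+_ (∑ n (f zero))) (∑-swap m n (f ∘ suc)))
        (≡-sym (∑-+ (f zero) (λ j → ∑ m (λ i → f (suc i) j))))

κ-sumFin : ∀ n (f : Fin n → ℕ) → κ (sumFin 0 ℕ._+_ n f) ≡ ∑ n (κ ∘ f)
κ-sumFin zero    f = refl
κ-sumFin (suc n) f = trans (κ-+ (f zero) (sumFin 0 ℕ._+_ n (f ∘ suc)))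
                           (cong (_+_ (κ (f zero))) (κ-sumFin n (f ∘ suc)))

κ-sumFin₂ : ∀ n (f : Fin n → Fin n → ℕ) →
  κ (sumFin 0 ℕ._+_ n (λ i → sumFin 0 ℕ._+_ n (f i))) ≡ ∑ n (λ i → ∑ n (λ j → κ (f i j)))
κ-sumFin₂ n f = trans (κ-sumFin n _) (∑-cong (λ i → κ-sumFin n (f i)))

-- Edge weights as a linear functional

module _ {n} (G : Graph n) where

  weight-mono : ∀ {v w : Fin n → Fin n → ℚ} →
    (∀ i j → isEdge G i j ≡ true → v i j ≤ w i j) → weight G v ≤ weight G w
  weight-mono {v} {w} v≤w = ∑-mono (λ i → ∑-mono (λ j → term i j (isEdge G i j) (v≤w i j)))
    where
    term : ∀ i j b → (b ≡ true → v i j ≤ w i j) →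
      (if b then v i j else 0ℚ) ≤ (if b then w i j else 0ℚ)
    term i j true  le = le refl
    term i j false le = ≤-refl

  weight-cong : ∀ {v w : Fin n → Fin n → ℚ} →
    (∀ i j → isEdge G i j ≡ true → v i j ≡ w i j) → weight G v ≡ weight G w
  weight-cong v≡w = ≤-antisym (weight-mono (λ i j e → ≤-reflexive (v≡w i j e)))
                              (weight-mono (λ i j e → ≤-reflexive (≡-sym (v≡w i j e))))

  weight-+ : ∀ (v w : Fin n → Fin n → ℚ) →
    weight G (λ i j → v i j + w i j) ≡ weight G v + weight G w
  weight-+ v w =
    trans (∑-cong (λ i → trans (∑-cong (λ j → term (isEdge G i j) (v i j) (w i j))) (∑-+ {n} _ _)))
          (∑-+ {n} _ _)
    where
    term : ∀ b x y → (if b then x + y else 0ℚ) ≡ (if b then x else 0ℚ) + (if b then y else 0ℚ)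
    term true  x y = refl
    term false x y = refl

  weight-* : ∀ c (w : Fin n → Fin n → ℚ) → weight G (λ i j → c * w i j) ≡ c * weight G w
  weight-* c w =
    trans (∑-cong (λ i → trans (∑-cong (λ j → term (isEdge G i j) (w i j))) (∑-* {n} c _)))
          (∑-* {n} c _)
    where
    term : ∀ b x → (if b then c * x else 0ℚ) ≡ c * (if b then x else 0ℚ)
    term true  x = refl
    term false x = ≡-sym (*-zeroʳ c)

  weight-const : ∀ c → weight G (λ _ _ → c) ≡ κ (edgeCount G) * c
  weight-const c =
    trans (weight-cong {w = λ _ _ → c * 1ℚ} (λ _ _ _ → ≡-sym (*-identityʳ c)))
    (trans (weight-* c (λ _ _ → 1ℚ)) (trans (*-comm c _) (cong (_* c) (≡-sym count))))
    where
    term : ∀ b → κ (if b then 1 else 0) ≡ (if b then 1ℚ else 0ℚ)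
    term true  = refl
    term false = refl
    count : κ (edgeCount G) ≡ weight G (λ _ _ → 1ℚ)
    count = trans (κ-sumFin₂ n _) (∑-cong (λ i → ∑-cong (λ j → term (isEdge G i j))))

  weight-edgeSet : ∀ (F : Fin n → Fin n → Bool) →
    κ (edgeSetSize G F) ≡ weight G (λ i j → ι (F i j))
  weight-edgeSet F =
    trans (κ-sumFin₂ n _) (∑-cong (λ i → ∑-cong (λ j → term (isEdge G i j) (F i j))))
    where
    term : ∀ b b′ → κ (if b ∧ b′ then 1 else 0) ≡ (if b then ι b′ else 0ℚ)
    term true  true  = refl
    term true  false = refl
    term false b′    = refl

  weight-∑ : ∀ m (w : Fin m → Fin n → Fin n → ℚ) →
    weight G (λ i j → ∑ m (λ v → w v i j)) ≡ ∑ m (λ v → weight G (w v))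
  weight-∑ zero    w = trans (weight-const 0ℚ) (*-zeroʳ (κ (edgeCount G)))
  weight-∑ (suc m) w = trans (weight-+ (w zero) _) (cong (_+_ (weight G (w zero))) (weight-∑ m (w ∘ suc)))

-- Random bipartitions

cons : ∀ {n} → Bool → (Fin n → Bool) → Fin (suc n) → Bool
cons b t zero    = b
cons b t (suc i) = t i

-- Expectation over independent bits, bit `i` being true with probability `p i`, computed by
-- conditioning on the first bit.
𝔼 : ∀ n → (Fin n → ℚ) → ((Fin n → Bool) → ℚ) → ℚ
𝔼 zero    p g = g (λ ())
𝔼 (suc n) p g = p zero * 𝔼 n (p ∘ suc) (g ∘ cons true)
              + (1ℚ - p zero) * 𝔼 n (p ∘ suc) (g ∘ cons false)

mix-const : ∀ p c → p * c + (1ℚ - p) * c ≡ c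
mix-const = solve-∀ ℚ-ring

𝔼-cong : ∀ n p {g h : (Fin n → Bool) → ℚ} → (∀ t → g t ≡ h t) → 𝔼 n p g ≡ 𝔼 n p h
𝔼-cong zero    p g≡h = g≡h (λ ())
𝔼-cong (suc n) p g≡h = cong₂ (λ x y → p zero * x + (1ℚ - p zero) * y)
  (𝔼-cong n (p ∘ suc) (g≡h ∘ cons true)) (𝔼-cong n (p ∘ suc) (g≡h ∘ cons false))

𝔼-const : ∀ n p c → 𝔼 n p (λ _ → c) ≡ c
𝔼-const zero    p c = refl
𝔼-const (suc n) p c =
  trans (cong (λ x → p zero * x + (1ℚ - p zero) * x) (𝔼-const n (p ∘ suc) c))
        (mix-const (p zero) c)

𝔼-+ : ∀ n p (g h : (Fin n → Bool) → ℚ) → 𝔼 n p (λ t → g t + h t) ≡ 𝔼 n p g + 𝔼 n p h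
𝔼-+ zero    p g h = refl
𝔼-+ (suc n) p g h =
  trans (cong₂ (λ x y → p zero * x + (1ℚ - p zero) * y)
           (𝔼-+ n (p ∘ suc) (g ∘ cons true) (h ∘ cons true))
           (𝔼-+ n (p ∘ suc) (g ∘ cons false) (h ∘ cons false)))
        (regroup (p zero) _ _ _ _)
  where
  regroup : ∀ p a b c d → p * (a + b) + (1ℚ - p) * (c + d) ≡
    (p * a + (1ℚ - p) * c) + (p * b + (1ℚ - p) * d)
  regroup = solve-∀ ℚ-ring

𝔼-∑ : ∀ n p m (g : Fin m → (Fin n → Bool) → ℚ) →
  𝔼 n p (λ t → ∑ m (λ k → g k t)) ≡ ∑ m (λ k → 𝔼 n p (g k))
𝔼-∑ n p zero    g = 𝔼-const n p 0ℚ
𝔼-∑ n p (suc m) g = trans (𝔼-+ n p (g zero) (λ t → ∑ m (λ k → g (suc k) t)))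
                          (cong (_+_ (𝔼 n p (g zero))) (𝔼-∑ n p m (g ∘ suc)))

-- With all `p i` in [0, 1] the expectation is an iterated convex combination. This is the averaging
-- principle that turns a bound for each bipartition into one for the random bipartition.
𝔼-lowerBound : ∀ n p {q} {g : (Fin n → Bool) → ℚ} → (∀ i → 0ℚ ≤ p i) → (∀ i → p i ≤ 1ℚ) →
  (∀ t → q ≤ g t) → q ≤ 𝔼 n p g
𝔼-lowerBound zero    p 0≤p p≤1 q≤g = q≤g (λ ())
𝔼-lowerBound (suc n) p {q} 0≤p p≤1 q≤g =
  ≤-respˡ (mix-const (p zero) q)
    (+-mono-≤ (*-monoˡ (0≤p zero) (𝔼-lowerBound n (p ∘ suc) (0≤p ∘ suc) (p≤1 ∘ suc) (q≤g ∘ cons true)))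
              (*-monoˡ (p≤q⇒0≤q-p (p≤1 zero))
                 (𝔼-lowerBound n (p ∘ suc) (0≤p ∘ suc) (p≤1 ∘ suc) (q≤g ∘ cons false))))

same : Bool → Bool → Bool
same true  b = b
same false b = not b

𝔼-bit : ∀ n p (i : Fin n) → 𝔼 n p (λ t → ι (t i)) ≡ p i
𝔼-bit (suc n) p zero =
  trans (cong₂ (λ x y → p zero * x + (1ℚ - p zero) * y)
           (𝔼-const n (p ∘ suc) 1ℚ) (𝔼-const n (p ∘ suc) 0ℚ))
        (simplify (p zero))
  where
  simplify : ∀ p → p * 1ℚ + (1ℚ - p) * 0ℚ ≡ p
  simplify = solve-∀ ℚ-ring
𝔼-bit (suc n) p (suc i) =
  trans (cong (λ x → p zero * x + (1ℚ - p zero) * x) (𝔼-bit n (p ∘ suc) i))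
        (mix-const (p zero) (p (suc i)))

𝔼-not-bit : ∀ n p (i : Fin n) → 𝔼 n p (λ t → ι (not (t i))) ≡ 1ℚ - p i
𝔼-not-bit (suc n) p zero =
  trans (cong₂ (λ x y → p zero * x + (1ℚ - p zero) * y)
           (𝔼-const n (p ∘ suc) 0ℚ) (𝔼-const n (p ∘ suc) 1ℚ))
        (simplify (p zero))
  where
  simplify : ∀ p → p * 0ℚ + (1ℚ - p) * 1ℚ ≡ 1ℚ - p
  simplify = solve-∀ ℚ-ring
𝔼-not-bit (suc n) p (suc i) =
  trans (cong (λ x → p zero * x + (1ℚ - p zero) * x) (𝔼-not-bit n (p ∘ suc) i))
        (mix-const (p zero) (1ℚ - p (suc i)))

-- The probability that two independent bits agree.
uncut : ℚ → ℚ → ℚ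
uncut p q = p * q + (1ℚ - p) * (1ℚ - q)

-- Bits at distinct vertices are independent. With i < j the recursion fixes bit `i` first, and the
-- one-bit expectations of bit `j` remain.
𝔼-same : ∀ n p (i j : Fin n) → toℕ i ℕ.< toℕ j →
  𝔼 n p (λ t → ι (same (t i) (t j))) ≡ uncut (p i) (p j)
𝔼-same (suc n) p zero    (suc j) _ =
  cong₂ (λ x y → p zero * x + (1ℚ - p zero) * y) (𝔼-bit n (p ∘ suc) j) (𝔼-not-bit n (p ∘ suc) j)
𝔼-same (suc n) p (suc i) (suc j) (s≤s i<j) =
  trans (cong (λ x → p zero * x + (1ℚ - p zero) * x) (𝔼-same n (p ∘ suc) i j i<j))
        (mix-const (p zero) (uncut (p (suc i)) (p (suc j))))

⌊⌋-true : ∀ {P : Set} {d : Dec P} → ⌊ d ⌋ ≡ true → P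
⌊⌋-true {d = yes p} _ = p

⌊⌋-false : ∀ {P : Set} {d : Dec P} → ⌊ d ⌋ ≡ false → ¬ P
⌊⌋-false {d = no ¬p} _ = ¬p

∧-trueˡ : ∀ {a b} → a ∧ b ≡ true → a ≡ true
∧-trueˡ {true} _ = refl

isEdge⇒< : ∀ {n} (G : Graph n) i j → isEdge G i j ≡ true → toℕ i ℕ.< toℕ j
isEdge⇒< G i j e = ⌊⌋-true {d = toℕ i ℕ.<? toℕ j} (∧-trueˡ e)

-- `A` takes precedence over `Z`; for an edge in neither, `u` is the chance that the bipartition
-- leaves it uncut.
removalProbability : Bool → Bool → ℚ → ℚ
removalProbability A Z u = if A then 1ℚ else (if Z then 0ℚ else u)

-- The removed edges are those of A together with the edges outside Z that are left uncut by a
-- random bipartition.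
τt≥⇒≤weight-removalProbability : ∀ {n} (G : Graph n) {q} (A Z : Fin n → Fin n → Bool) (p : Fin n → ℚ) →
  (∀ i → 0ℚ ≤ p i) → (∀ i → p i ≤ 1ℚ) →
  (∀ i j k → IsTriangle G i j k → A i j ≡ false → A j k ≡ false → A i k ≡ false →
     Z i j ≡ false × Z j k ≡ false × Z i k ≡ false) →
  τt≥ G q → q ≤ weight G (λ i j → removalProbability (A i j) (Z i j) (uncut (p i) (p j)))
τt≥⇒≤weight-removalProbability {n} G {q} A Z p 0≤p p≤1 covers τ≥q =
  subst (q ≤_) expectation (𝔼-lowerBound n p 0≤p p≤1 bound)
  where
  removed : (Fin n → Bool) → Fin n → Fin n → Bool
  removed t i j = A i j ∨ (not (Z i j) ∧ same (t i) (t j))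

  -- Two of the three vertices lie on the same side, so every triangle has an uncut edge.
  pigeonhole : ∀ a b c → (not (same a b) ∧ not (same b c) ∧ not (same a c)) ≡ true → ⊥
  pigeonhole true  true  c     ()
  pigeonhole true  false true  ()
  pigeonhole true  false false ()
  pigeonhole false false c     ()
  pigeonhole false true  true  ()
  pigeonhole false true  false ()

  -- A triangle that avoids `A` has no edge in `Z`, so its uncut edge is removed.
  survivor : ∀ a₁ a₂ a₃ z₁ z₂ z₃ b₁ b₂ b₃ →
    (a₁ ≡ false → a₂ ≡ false → a₃ ≡ false → z₁ ≡ false × z₂ ≡ false × z₃ ≡ false) →
    ((not b₁ ∧ not b₂ ∧ not b₃) ≡ true → ⊥) →
    (not (a₁ ∨ (not z₁ ∧ b₁)) ∧ not (a₂ ∨ (not z₂ ∧ b₂)) ∧ not (a₃ ∨ (not z₃ ∧ b₃))) ≡ true → ⊥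
  survivor false false false z₁ z₂ z₃ b₁ b₂ b₃ cov cut h with cov refl refl refl
  ... | refl , refl , refl = cut h
  survivor true  a₂    a₃   z₁ z₂ z₃ b₁ b₂ b₃ cov cut ()
  survivor false true  a₃   z₁ z₂ z₃ b₁ b₂ b₃ cov cut h with not (not z₁ ∧ b₁)
  survivor false true  a₃   z₁ z₂ z₃ b₁ b₂ b₃ cov cut () | true
  survivor false true  a₃   z₁ z₂ z₃ b₁ b₂ b₃ cov cut () | false
  survivor false false true z₁ z₂ z₃ b₁ b₂ b₃ cov cut h
    with not (not z₁ ∧ b₁) | not (not z₂ ∧ b₂)
  survivor false false true z₁ z₂ z₃ b₁ b₂ b₃ cov cut () | true  | true
  survivor false false true z₁ z₂ z₃ b₁ b₂ b₃ cov cut () | true  | false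
  survivor false false true z₁ z₂ z₃ b₁ b₂ b₃ cov cut () | false | _

  triangleFree : ∀ t → TriangleFreeAfterRemoval G (removed t)
  triangleFree t i j k tri =
    survivor (A i j) (A j k) (A i k) (Z i j) (Z j k) (Z i k) _ _ _
      (covers i j k tri) (pigeonhole (t i) (t j) (t k))

  bound : ∀ t → q ≤ weight G (λ i j → ι (removed t i j))
  bound t = subst (q ≤_) (weight-edgeSet G (removed t)) (τ≥q (removed t) (triangleFree t))

  term : ∀ i j a z → toℕ i ℕ.< toℕ j →
    𝔼 n p (λ t → ι (a ∨ (not z ∧ same (t i) (t j)))) ≡ removalProbability a z (uncut (p i) (p j))
  term i j true  z     i<j = 𝔼-const n p 1ℚ
  term i j false true  i<j = 𝔼-const n p 0ℚ
  term i j false false i<j = 𝔼-same n p i j i<j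

  𝔼-if : ∀ b (g : (Fin n → Bool) → ℚ) →
    𝔼 n p (λ t → if b then g t else 0ℚ) ≡ (if b then 𝔼 n p g else 0ℚ)
  𝔼-if true  g = refl
  𝔼-if false g = 𝔼-const n p 0ℚ

  expectation : 𝔼 n p (λ t → weight G (λ i j → ι (removed t i j))) ≡
    weight G (λ i j → removalProbability (A i j) (Z i j) (uncut (p i) (p j)))
  expectation =
    trans (𝔼-∑ n p n _)
    (trans (∑-cong (λ i → trans (𝔼-∑ n p n _)
                         (∑-cong (λ j → 𝔼-if (isEdge G i j) (λ t → ι (removed t i j))))))
           (weight-cong G (λ i j e → term i j (A i j) (Z i j) (isEdge⇒< G i j e))))

-- Rounding at a random threshold

heavy light : ℚ → ℚ → Bool
heavy θ x = ⌊ (1ℚ - θ) * ½ ≤? x ⌋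
light θ x = ⌊ x ≤? θ ⌋

-- The expected loss at level θ from an edge of value x, under a fair bipartition.
φ : ℚ → ℚ → ℚ
φ θ x = removalProbability (heavy θ x) (light θ x) ½

-- A value at most θ and two values below (1 - θ)/2 sum to less than 1.
no-light-without-heavy : ∀ θ {x y z} → 1ℚ ≤ (x + y) + z →
  heavy θ y ≡ false → heavy θ z ≡ false → light θ x ≡ false
no-light-without-heavy θ {x} {y} {z} 1≤ y-heavy z-heavy with x ≤? θ
... | no  _   = refl
... | yes x≤θ = ⊥-elim (<-irrefl refl (≤-<-trans 1≤
        (subst (_ <ℚ_) (total θ)
          (+-mono-< (+-mono-≤-< x≤θ (≰⇒> (⌊⌋-false y-heavy))) (≰⇒> (⌊⌋-false z-heavy))))))
  where
  total : ∀ θ → (θ + (1ℚ - θ) * ½) + (1ℚ - θ) * ½ ≡ 1ℚ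
  total = solve-∀ ℚ-ring

τt≥⇒≤weight-φ : ∀ {n} (G : Graph n) {q f} → IsFractionalTriangleCover G f → τt≥ G q →
  ∀ θ → q ≤ weight G (λ i j → φ θ (f i j))
τt≥⇒≤weight-φ G {f = f} (_ , cover) τ≥q θ =
  τt≥⇒≤weight-removalProbability G (λ i j → heavy θ (f i j)) (λ i j → light θ (f i j)) (λ _ → ½)
    (λ _ → nonNegative⁻¹ ½) (λ _ → 0≤d≡q-p⇒p≤q (nonNegative⁻¹ ½) refl) covers τ≥q
  where
  swap₁₂ : ∀ x y z → (x + y) + z ≡ (y + x) + z
  swap₁₂ = solve-∀ ℚ-ring
  swap₁₃ : ∀ x y z → (x + y) + z ≡ (z + y) + x
  swap₁₃ = solve-∀ ℚ-ring
  covers : ∀ i j k → IsTriangle G i j k →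
    heavy θ (f i j) ≡ false → heavy θ (f j k) ≡ false → heavy θ (f i k) ≡ false →
    light θ (f i j) ≡ false × light θ (f j k) ≡ false × light θ (f i k) ≡ false
  covers i j k tri hij hjk hik =
      no-light-without-heavy θ (cover i j k tri) hjk hik
    , no-light-without-heavy θ (subst (1ℚ ≤_) (swap₁₂ (f i j) (f j k) (f i k)) (cover i j k tri)) hij hik
    , no-light-without-heavy θ (subst (1ℚ ≤_) (swap₁₃ (f i j) (f j k) (f i k)) (cover i j k tri)) hjk hij

φ≤1 : ∀ θ x → φ θ x ≤ 1ℚ
φ≤1 θ x with (1ℚ - θ) * ½ ≤? x | x ≤? θ
... | yes _ | _     = ≤-refl
... | no  _ | yes _ = nonNegative⁻¹ 1ℚ
... | no  _ | no  _ = 0≤d≡q-p⇒p≤q (nonNegative⁻¹ ½) refl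

φ≤½ : ∀ θ x → x <ℚ (1ℚ - θ) * ½ → φ θ x ≤ ½
φ≤½ θ x x< with (1ℚ - θ) * ½ ≤? x | x ≤? θ
... | yes x≥ | _     = ⊥-elim (<-irrefl refl (<-≤-trans x< x≥))
... | no  _  | yes _ = nonNegative⁻¹ ½
... | no  _  | no  _ = ≤-refl

φ≤0 : ∀ θ x → x <ℚ (1ℚ - θ) * ½ → x ≤ θ → φ θ x ≤ 0ℚ
φ≤0 θ x x< x≤θ with (1ℚ - θ) * ½ ≤? x | x ≤? θ
... | yes x≥ | _       = ⊥-elim (<-irrefl refl (<-≤-trans x< x≥))
... | no  _  | yes _   = ≤-refl
... | no  _  | no  x≰θ = ⊥-elim (x≰θ x≤θ)

≤-<-connex : ∀ p q → p ≤ q ⊎ q <ℚ p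
≤-<-connex p q with p ≤? q
... | yes p≤q = inj₁ p≤q
... | no  p≰q = inj₂ (≰⇒> p≰q)

⅓ : ℚ
⅓ = + 1 / 3

-- The Riemann sum of 2 φ θ x over the levels θ = h , 2h , … , kh.
module Levels (h : ℚ) (0≤h : 0ℚ ≤ h) where

  level : ℕ → ℚ
  level zero    = 0ℚ
  level (suc k) = level k + h

  Φ : ℕ → ℚ → ℚ
  Φ zero    x = 0ℚ
  Φ (suc k) x = Φ k x + (h + h) * φ (level (suc k)) x

  level-≤-suc : ∀ k → level k ≤ level (suc k)
  level-≤-suc k = 0≤d≡q-p⇒p≤q 0≤h (gap (level k) h)
    where
    gap : ∀ l h → h ≡ l + h - l
    gap = solve-∀ ℚ-ring

  private
    step : ∀ {P p q} c → P ≤ q → p ≤ c → P + (h + h) * p ≤ q + (h + h) * c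
    step c P≤q p≤c = +-mono-≤ P≤q (*-monoˡ (+-nonneg 0≤h 0≤h) p≤c)

    half : ∀ q h → q + (h + h) * ½ ≡ q + h
    half = solve-∀ ℚ-ring

  Φ≤2level : ∀ k x → Φ k x ≤ level k + level k
  Φ≤2level zero    x = ≤-refl
  Φ≤2level (suc k) x =
    ≤-respʳ (regroup (level k) h) (step 1ℚ (Φ≤2level k x) (φ≤1 (level (suc k)) x))
    where
    regroup : ∀ l h → (l + l) + (h + h) * 1ℚ ≡ (l + h) + (l + h)
    regroup = solve-∀ ℚ-ring

  -- For θ ≤ 1/3 the heavy bound (1 - θ)/2 is at least 1/3.
  below-heavy : ∀ {θ x} → θ ≤ ⅓ → x <ℚ ⅓ → x <ℚ (1ℚ - θ) * ½
  below-heavy {θ} {x} θ≤⅓ x<⅓ = <-≤-trans x<⅓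
    (0≤d≡q-p⇒p≤q (*-nonneg (nonNegative⁻¹ ½) (p≤q⇒0≤q-p θ≤⅓)) (gap θ))
    where
    gap : ∀ θ → ½ * (⅓ - θ) ≡ (1ℚ - θ) * ½ - ⅓
    gap = solve-∀ ℚ-ring

  Φ≤level : ∀ k x → x <ℚ ⅓ → level k ≤ ⅓ → Φ k x ≤ level k
  Φ≤level zero    x x<⅓ _    = ≤-refl
  Φ≤level (suc k) x x<⅓ l≤⅓ =
    ≤-respʳ (half (level k) h)
      (step ½ (Φ≤level k x x<⅓ (≤-trans (level-≤-suc k) l≤⅓)) (φ≤½ (level (suc k)) x (below-heavy l≤⅓ x<⅓)))

  -- A value below 1/3 is never heavy at these levels and costs at most 1/2 at levels below x,
  -- nothing from x on. Sampling at right endpoints means that the levels below x have total length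
  -- at most x, so no discretisation error arises here.
  Φ≤x : ∀ k x → 0ℚ ≤ x → x <ℚ ⅓ → level k ≤ ⅓ → Φ k x ≤ x
  Φ≤x zero    x 0≤x x<⅓ _    = 0≤x
  Φ≤x (suc k) x 0≤x x<⅓ l≤⅓ with ≤-total x (level (suc k))
  ... | inj₁ x≤l = ≤-respʳ (vanish x h)
          (step 0ℚ (Φ≤x k x 0≤x x<⅓ (≤-trans (level-≤-suc k) l≤⅓))
                   (φ≤0 (level (suc k)) x (below-heavy l≤⅓ x<⅓) x≤l))
    where
    vanish : ∀ x h → x + (h + h) * 0ℚ ≡ x
    vanish = solve-∀ ℚ-ring
  ... | inj₂ l≤x = ≤-trans (Φ≤level (suc k) x x<⅓ l≤⅓) l≤x

  -- Here b bounds h times the number of levels j ≤ k at which x is heavy, i.e. with jh ≥ 1 - 2x.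
  Φ≤level+b : ∀ k x b → 0ℚ ≤ b → level (suc k) - (1ℚ - (x + x)) ≤ b → Φ k x ≤ level k + b
  Φ≤level+b zero    x b 0≤b _ = subst (_≤ 0ℚ + b) (+-identityʳ 0ℚ) (+-monoʳ-≤ 0ℚ 0≤b)
  Φ≤level+b (suc k) x b 0≤b slack≤b with ≤-<-connex ((1ℚ - level (suc k)) * ½) x
  -- The last level is heavy and costs 2h, of which h is charged to `b`. The hypothesis on `b` looks
  -- one level ahead, so heaviness at this level forces h ≤ b and `b - h` is again admissible.
  ... | inj₁ l≤ = ≤-respʳ (regroup (level k) b h)
          (step 1ℚ (Φ≤level+b k x (b - h)
                      (0≤d≡q-p⇒p≤q (+-nonneg (+-nonneg (p≤q⇒0≤q-p l≤) (p≤q⇒0≤q-p l≤)) (p≤q⇒0≤q-p slack≤b))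
                                   (nonneg (level k) h x b))
                      (0≤d≡q-p⇒p≤q (p≤q⇒0≤q-p slack≤b) (shift (level k) h x b)))
                   (φ≤1 (level (suc k)) x))
    where
    regroup : ∀ l b h → (l + (b - h)) + (h + h) * 1ℚ ≡ (l + h) + b
    regroup = solve-∀ ℚ-ring
    nonneg : ∀ l h x b →
      ((x - (1ℚ - (l + h)) * ½) + (x - (1ℚ - (l + h)) * ½)) + (b - (((l + h) + h) - (1ℚ - (x + x))))
      ≡ (b - h) - 0ℚ
    nonneg = solve-∀ ℚ-ring
    shift : ∀ l h x b → b - (((l + h) + h) - (1ℚ - (x + x))) ≡ (b - h) - ((l + h) - (1ℚ - (x + x)))
    shift = solve-∀ ℚ-ring
  ... | inj₂ x< = ≤-respʳ (regroup (level k) b h)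
          (step ½ (Φ≤level+b k x b 0≤b
                      (≤-trans (+-monoˡ-≤ (- (1ℚ - (x + x))) (level-≤-suc (suc k))) slack≤b))
                  (φ≤½ (level (suc k)) x x<))
    where
    regroup : ∀ l b h → (l + b) + (h + h) * ½ ≡ (l + h) + b
    regroup = solve-∀ ℚ-ring

  module _ (K : ℕ) (level-K : level K ≡ ⅓) where

    private
      l≤⅓ : level K ≤ ⅓
      l≤⅓ = ≤-reflexive level-K

      Φ≤mid : ∀ x → ⅓ ≤ x → Φ K x ≤ ⅓ + ((⅓ + h) - (1ℚ - (x + x)))
      Φ≤mid x ⅓≤x = subst (λ l → Φ K x ≤ l + ((l + h) - (1ℚ - (x + x)))) level-K
        (Φ≤level+b K x ((level K + h) - (1ℚ - (x + x)))
          (subst (λ l → 0ℚ ≤ (l + h) - (1ℚ - (x + x))) (≡-sym level-K)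
            (0≤d≡q-p⇒p≤q (+-nonneg 0≤h (+-nonneg 0≤x-⅓ 0≤x-⅓)) (nonneg x h)))
          ≤-refl)
        where
        0≤x-⅓ = p≤q⇒0≤q-p ⅓≤x
        nonneg : ∀ x h → h + ((x - ⅓) + (x - ⅓)) ≡ ((⅓ + h) - (1ℚ - (x + x))) - 0ℚ
        nonneg = solve-∀ ℚ-ring

      Φ≤top : ∀ x → Φ K x ≤ ⅓ + ⅓
      Φ≤top x = subst (λ l → Φ K x ≤ l + l) level-K (Φ≤2level K x)

    Φ-excess-heavy : ∀ x → 0ℚ ≤ x →
      + 3 / 1 * Φ K x + ι ⌊ + 3 / 4 ≤? x ⌋ ≤ + 4 / 1 * x + + 3 / 1 * h
    Φ-excess-heavy x 0≤x with + 3 / 4 ≤? x | ≤-<-connex ⅓ x | ≤-total ½ x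
    ... | yes ¾≤x | _ | _ =
      0≤d≡q-p⇒p≤q (+-nonneg (*-nonneg (nonNegative⁻¹ (+ 3 / 1)) (p≤q⇒0≤q-p (Φ≤top x)))
                   (+-nonneg (*-nonneg (nonNegative⁻¹ (+ 4 / 1)) (p≤q⇒0≤q-p ¾≤x))
                             (*-nonneg (nonNegative⁻¹ (+ 3 / 1)) 0≤h)))
                  (identity (Φ K x) x h)
      where
      identity : ∀ P x h →
        + 3 / 1 * ((⅓ + ⅓) - P) + (+ 4 / 1 * (x - + 3 / 4) + + 3 / 1 * h)
        ≡ (+ 4 / 1 * x + + 3 / 1 * h) - (+ 3 / 1 * P + 1ℚ)
      identity = solve-∀ ℚ-ring
    ... | no _ | _ | inj₁ ½≤x =
      0≤d≡q-p⇒p≤q (+-nonneg (*-nonneg (nonNegative⁻¹ (+ 3 / 1)) (p≤q⇒0≤q-p (Φ≤top x)))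
                   (+-nonneg (*-nonneg (nonNegative⁻¹ (+ 4 / 1)) (p≤q⇒0≤q-p ½≤x))
                             (*-nonneg (nonNegative⁻¹ (+ 3 / 1)) 0≤h)))
                  (identity (Φ K x) x h)
      where
      identity : ∀ P x h →
        + 3 / 1 * ((⅓ + ⅓) - P) + (+ 4 / 1 * (x - ½) + + 3 / 1 * h)
        ≡ (+ 4 / 1 * x + + 3 / 1 * h) - (+ 3 / 1 * P + 0ℚ)
      identity = solve-∀ ℚ-ring
    ... | no _ | inj₁ ⅓≤x | inj₂ x≤½ =
      0≤d≡q-p⇒p≤q (+-nonneg (*-nonneg (nonNegative⁻¹ (+ 3 / 1)) (p≤q⇒0≤q-p (Φ≤mid x ⅓≤x)))
                             (*-nonneg (nonNegative⁻¹ (+ 2 / 1)) (p≤q⇒0≤q-p x≤½)))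
                  (identity (Φ K x) x h)
      where
      identity : ∀ P x h →
        + 3 / 1 * ((⅓ + ((⅓ + h) - (1ℚ - (x + x)))) - P) + + 2 / 1 * (½ - x)
        ≡ (+ 4 / 1 * x + + 3 / 1 * h) - (+ 3 / 1 * P + 0ℚ)
      identity = solve-∀ ℚ-ring
    ... | no _ | inj₂ x<⅓ | inj₂ _ =
      0≤d≡q-p⇒p≤q (+-nonneg (*-nonneg (nonNegative⁻¹ (+ 3 / 1)) (p≤q⇒0≤q-p (Φ≤x K x 0≤x x<⅓ l≤⅓)))
                   (+-nonneg 0≤x (*-nonneg (nonNegative⁻¹ (+ 3 / 1)) 0≤h)))
                  (identity (Φ K x) x h)
      where
      identity : ∀ P x h →
        + 3 / 1 * (x - P) + (x + + 3 / 1 * h) ≡ (+ 4 / 1 * x + + 3 / 1 * h) - (+ 3 / 1 * P + 0ℚ)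
      identity = solve-∀ ℚ-ring

    -- With the same bounds on Φ, the slope 26 is fixed by equality at 1/2, where 18 · 2/3 + 1 = 13.
    -- Below 1/3 the surplus is 8x, which pays for the extra 1 as soon as x ≥ 1/8; smaller values
    -- need the indicator.
    Φ-excess-light : ∀ x → 0ℚ ≤ x →
      + 18 / 1 * Φ K x + 1ℚ ≤ (+ 26 / 1 * x + + 18 / 1 * h) + ι ⌊ x ≤? + 1 / 8 ⌋
    Φ-excess-light x 0≤x with x ≤? + 1 / 8 | ≤-<-connex ⅓ x | ≤-total ½ x
    ... | Z? | _ | inj₁ ½≤x =
      ≤-trans (0≤d≡q-p⇒p≤q (+-nonneg (*-nonneg (nonNegative⁻¹ (+ 18 / 1)) (p≤q⇒0≤q-p (Φ≤top x)))
                             (+-nonneg (*-nonneg (nonNegative⁻¹ (+ 26 / 1)) (p≤q⇒0≤q-p ½≤x))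
                                       (*-nonneg (nonNegative⁻¹ (+ 18 / 1)) 0≤h)))
                           (identity (Φ K x) x h))
              (+-monoʳ-≤ (+ 26 / 1 * x + + 18 / 1 * h) (0≤ι ⌊ Z? ⌋))
      where
      identity : ∀ P x h →
        + 18 / 1 * ((⅓ + ⅓) - P) + (+ 26 / 1 * (x - ½) + + 18 / 1 * h)
        ≡ ((+ 26 / 1 * x + + 18 / 1 * h) + 0ℚ) - (+ 18 / 1 * P + 1ℚ)
      identity = solve-∀ ℚ-ring
    ... | Z? | inj₁ ⅓≤x | inj₂ x≤½ =
      ≤-trans (0≤d≡q-p⇒p≤q (+-nonneg (*-nonneg (nonNegative⁻¹ (+ 18 / 1)) (p≤q⇒0≤q-p (Φ≤mid x ⅓≤x)))
                                       (*-nonneg (nonNegative⁻¹ (+ 10 / 1)) (p≤q⇒0≤q-p x≤½)))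
                           (identity (Φ K x) x h))
              (+-monoʳ-≤ (+ 26 / 1 * x + + 18 / 1 * h) (0≤ι ⌊ Z? ⌋))
      where
      identity : ∀ P x h →
        + 18 / 1 * ((⅓ + ((⅓ + h) - (1ℚ - (x + x)))) - P) + + 10 / 1 * (½ - x)
        ≡ ((+ 26 / 1 * x + + 18 / 1 * h) + 0ℚ) - (+ 18 / 1 * P + 1ℚ)
      identity = solve-∀ ℚ-ring
    ... | no x≰⅛ | inj₂ x<⅓ | inj₂ _ =
      0≤d≡q-p⇒p≤q (+-nonneg (*-nonneg (nonNegative⁻¹ (+ 18 / 1)) (p≤q⇒0≤q-p (Φ≤x K x 0≤x x<⅓ l≤⅓)))
                   (+-nonneg (*-nonneg (nonNegative⁻¹ (+ 8 / 1)) (p≤q⇒0≤q-p (<⇒≤ (≰⇒> x≰⅛))))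
                             (*-nonneg (nonNegative⁻¹ (+ 18 / 1)) 0≤h)))
                  (identity (Φ K x) x h)
      where
      identity : ∀ P x h →
        + 18 / 1 * (x - P) + (+ 8 / 1 * (x - + 1 / 8) + + 18 / 1 * h)
        ≡ ((+ 26 / 1 * x + + 18 / 1 * h) + 0ℚ) - (+ 18 / 1 * P + 1ℚ)
      identity = solve-∀ ℚ-ring
    ... | yes _ | inj₂ x<⅓ | inj₂ _ =
      0≤d≡q-p⇒p≤q (+-nonneg (*-nonneg (nonNegative⁻¹ (+ 18 / 1)) (p≤q⇒0≤q-p (Φ≤x K x 0≤x x<⅓ l≤⅓)))
                   (+-nonneg (*-nonneg (nonNegative⁻¹ (+ 8 / 1)) 0≤x)
                             (*-nonneg (nonNegative⁻¹ (+ 18 / 1)) 0≤h)))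
                  (identity (Φ K x) x h)
      where
      identity : ∀ P x h →
        + 18 / 1 * (x - P) + (+ 8 / 1 * x + + 18 / 1 * h)
        ≡ ((+ 26 / 1 * x + + 18 / 1 * h) + 1ℚ) - (+ 18 / 1 * P + 1ℚ)
      identity = solve-∀ ℚ-ring

  -- Each level gives the same lower bound `q` on its expected loss and enters the Riemann sum with
  -- factor 2h.
  weight-Φ-lower : ∀ {n} (G : Graph n) {q f} → IsFractionalTriangleCover G f → τt≥ G q →
    ∀ k → (level k + level k) * q ≤ weight G (λ i j → Φ k (f i j))
  weight-Φ-lower G {q} {f} cov τ≥q zero =
    ≤-reflexive (trans (*-zeroˡ q) (≡-sym (trans (weight-const G 0ℚ) (*-zeroʳ (κ (edgeCount G))))))
  weight-Φ-lower G {q} {f} cov τ≥q (suc k) =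
    ≤-respˡ (expand (level k) h q)
      (≤-respʳ
        (≡-sym (trans (weight-+ G _ _) (cong (_+_ (weight G (λ i j → Φ k (f i j)))) (weight-* G (h + h) _))))
        (+-mono-≤ (weight-Φ-lower G cov τ≥q k)
                  (*-monoˡ (+-nonneg 0≤h 0≤h) (τt≥⇒≤weight-φ G cov τ≥q (level (suc k))))))
    where
    expand : ∀ l h q → (l + l) * q + (h + h) * q ≡ ((l + h) + (l + h)) * q
    expand = solve-∀ ℚ-ring

-- Light edges and biased bipartitions

*-pos : ∀ {p q} → 0ℚ <ℚ p → 0ℚ <ℚ q → 0ℚ <ℚ p * q
*-pos {p} {q} 0<p 0<q =
  positive⁻¹ (p * q) {{pos*pos⇒pos p {{positive 0<p}} q {{positive 0<q}}}}

square-nonneg : ∀ p → 0ℚ ≤ p * p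
square-nonneg p with ≤-total 0ℚ p
... | inj₁ 0≤p = *-nonneg 0≤p 0≤p
... | inj₂ p≤0 = ≤-respʳ (negate² p) (*-nonneg 0≤-p 0≤-p)
  where
  0≤-p = p≤q⇒0≤q-p p≤0
  negate² : ∀ p → (0ℚ - p) * (0ℚ - p) ≡ p * p
  negate² = solve-∀ ℚ-ring

module DegreeSquares {n} (ζ : Fin n → Fin n → ℚ) where

  -- Symmetrises weights stored on ordered pairs, so that `D` becomes a weighted degree.
  z : Fin n → Fin n → ℚ
  z v u = ζ v u + ζ u v

  D : Fin n → ℚ
  D u = ∑ n (λ v → z v u)

  total : ℚ
  total = ∑ n (λ i → ∑ n (ζ i))

  ∑D≡2total : ∑ n D ≡ total + total
  ∑D≡2total =
    trans (∑-cong (λ u → ∑-+ (λ v → ζ v u) (ζ u)))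
    (trans (∑-+ (λ u → ∑ n (λ v → ζ v u)) (λ u → ∑ n (ζ u)))
           (cong (_+ total) (∑-swap n n (λ u v → ζ v u))))

  -- Double counting: one factor `D u` is expanded over the pairs at `u`, so each pair collects the
  -- degrees of both its ends.
  ∑D²≡ : ∑ n (λ u → D u * D u) ≡ ∑ n (λ i → ∑ n (λ j → ζ i j * (D i + D j)))
  ∑D²≡ =
    trans (∑-cong (λ u → trans (≡-sym (∑-* (D u) (λ v → z v u)))
                        (trans (∑-cong (λ v → expand (D u) (ζ v u) (ζ u v)))
                               (∑-+ (λ v → ζ v u * D u) (λ v → ζ u v * D u)))))
    (trans (∑-+ (λ u → ∑ n (λ v → ζ v u * D u)) (λ u → ∑ n (λ v → ζ u v * D u)))
    (trans (cong (_+ ∑ n (λ u → ∑ n (λ v → ζ u v * D u))) (∑-swap n n (λ u v → ζ v u * D u)))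
    (trans (≡-sym (∑-+ (λ i → ∑ n (λ j → ζ i j * D j)) (λ i → ∑ n (λ j → ζ i j * D i))))
           (∑-cong (λ i → trans (≡-sym (∑-+ (λ j → ζ i j * D j) (λ j → ζ i j * D i)))
                                (∑-cong (λ j → collect (ζ i j) (D i) (D j))))))))
    where
    expand : ∀ d a b → d * (a + b) ≡ a * d + b * d
    expand = solve-∀ ℚ-ring
    collect : ∀ a d e → a * e + a * d ≡ a * (d + e)
    collect = solve-∀ ℚ-ring

  -- Cauchy–Schwarz in its tangent-line form 2tD - t² ≤ D².
  ∑D²-lower : ∀ t → + 4 / 1 * t * total - κ n * (t * t) ≤ ∑ n (λ u → D u * D u)
  ∑D²-lower t = ≤-respˡ tangents (∑-mono (λ u → tangent (D u)))
    where
    tangent : ∀ d → (t + t) * d + - (t * t) ≤ d * d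
    tangent d = 0≤d≡q-p⇒p≤q (square-nonneg (d - t)) (identity d t)
      where
      identity : ∀ d t → (d - t) * (d - t) ≡ d * d - ((t + t) * d + - (t * t))
      identity = solve-∀ ℚ-ring
    tangents : ∑ n (λ u → (t + t) * D u + - (t * t)) ≡ + 4 / 1 * t * total - κ n * (t * t)
    tangents =
      trans (∑-+ (λ u → (t + t) * D u) (λ _ → - (t * t)))
      (trans (cong₂ _+_ (trans (∑-* (t + t) D) (cong ((t + t) *_) ∑D≡2total)) (∑-const n (- (t * t))))
             (collect t total (κ n)))
      where
      collect : ∀ t Z k → (t + t) * (Z + Z) + k * (- (t * t)) ≡ + 4 / 1 * t * Z - k * (t * t)
      collect = solve-∀ ℚ-ring

⅛ ¾ : ℚ
⅛ = + 1 / 8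
¾ = + 3 / 4

module LightEdges {n} (G : Graph n) (f : Fin n → Fin n → ℚ) (cov : IsFractionalTriangleCover G f) where

  Light : Fin n → Fin n → Set
  Light i j = isEdge G i j ≡ true × f i j ≤ ⅛

  -- Written as the summand of `weight`, so that `total` is by definition the number of light edges.
  ζ : Fin n → Fin n → ℚ
  ζ i j = if isEdge G i j then ι ⌊ f i j ≤? ⅛ ⌋ else 0ℚ

  open DegreeSquares ζ

  heavies : ℚ
  heavies = weight G (λ i j → ι ⌊ ¾ ≤? f i j ⌋)

  ζ-values : ∀ i j → (ζ i j ≡ 0ℚ) ⊎ (ζ i j ≡ 1ℚ × Light i j)
  ζ-values i j with isEdge G i j | f i j ≤? ⅛
  ... | false | _       = inj₁ refl
  ... | true  | no  _   = inj₁ refl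
  ... | true  | yes f≤⅛ = inj₂ (refl , refl , f≤⅛)

  edge-asym : ∀ {i j} → isEdge G i j ≡ true → isEdge G j i ≡ true → ⊥
  edge-asym {i} {j} e e′ = ℕₚ.<-asym (isEdge⇒< G i j e) (isEdge⇒< G j i e′)

  z-values : ∀ v u → (z v u ≡ 0ℚ) ⊎ (z v u ≡ 1ℚ × (Light v u ⊎ Light u v))
  z-values v u with ζ-values v u | ζ-values u v
  ... | inj₁ a       | inj₁ b       = inj₁ (cong₂ _+_ a b)
  ... | inj₁ a       | inj₂ (b , l) = inj₂ (cong₂ _+_ a b , inj₂ l)
  ... | inj₂ (a , l) | inj₁ b       = inj₂ (cong₂ _+_ a b , inj₁ l)
  ... | inj₂ (_ , e , _) | inj₂ (_ , e′ , _) = ⊥-elim (edge-asym e e′)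

  0≤z : ∀ v u → 0ℚ ≤ z v u
  0≤z v u with z-values v u
  ... | inj₁ z≡0       = ≤-reflexive (≡-sym z≡0)
  ... | inj₂ (z≡1 , _) = ≤-respʳ (≡-sym z≡1) (nonNegative⁻¹ 1ℚ)

  z≤1 : ∀ v u → z v u ≤ 1ℚ
  z≤1 v u with z-values v u
  ... | inj₁ z≡0       = ≤-respˡ (≡-sym z≡0) (nonNegative⁻¹ 1ℚ)
  ... | inj₂ (z≡1 , _) = ≤-reflexive z≡1

  -- This ties the two cutoffs together: 1 - 1/8 - 1/8 = 3/4.
  third-edge-heavy : ∀ {a b c} → a ≤ ⅛ → b ≤ ⅛ → 1ℚ ≤ (a + b) + c → ¾ ≤ c
  third-edge-heavy {a} {b} {c} a≤ b≤ 1≤ =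
    0≤d≡q-p⇒p≤q (+-nonneg (p≤q⇒0≤q-p 1≤) (+-nonneg (p≤q⇒0≤q-p a≤) (p≤q⇒0≤q-p b≤))) (identity a b c)
    where
    identity : ∀ a b c → (((a + b) + c) - 1ℚ) + ((⅛ - a) + (⅛ - b)) ≡ c - ¾
    identity = solve-∀ ℚ-ring

  light-pair⇒heavy : ∀ v i j → isEdge G i j ≡ true →
    Light v i ⊎ Light i v → Light v j ⊎ Light j v → ¾ ≤ f i j
  light-pair⇒heavy v i j e (inj₁ (vi , lvi)) (inj₁ (vj , lvj)) =
    third-edge-heavy lvi lvj (≤-respʳ (rotate (f v i) (f i j) (f v j)) (proj₂ cov v i j (vi , e , vj)))
    where
    rotate : ∀ a c b → (a + c) + b ≡ (a + b) + c
    rotate = solve-∀ ℚ-ring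
  -- Here j < v < i, against i < j; the other three cases are the possible positions of `v`.
  light-pair⇒heavy v i j e (inj₁ (vi , _)) (inj₂ (jv , _)) =
    ⊥-elim (ℕₚ.<-asym (isEdge⇒< G i j e)
              (ℕₚ.<-trans (isEdge⇒< G j v jv) (isEdge⇒< G v i vi)))
  light-pair⇒heavy v i j e (inj₂ (iv , liv)) (inj₁ (vj , lvj)) =
    third-edge-heavy liv lvj (proj₂ cov i v j (iv , vj , e))
  light-pair⇒heavy v i j e (inj₂ (iv , liv)) (inj₂ (jv , ljv)) =
    third-edge-heavy ljv liv (≤-respʳ (rotate (f i j) (f j v) (f i v)) (proj₂ cov i j v (e , jv , iv)))
    where
    rotate : ∀ c a b → (c + a) + b ≡ (a + b) + c
    rotate = solve-∀ ℚ-ring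

  -- Controls the product term of a biased cut: it is nonzero only on edges joining two light
  -- neighbours of `v`.
  zz≤heavy : ∀ v i j → isEdge G i j ≡ true → z v i * z v j ≤ ι ⌊ ¾ ≤? f i j ⌋
  zz≤heavy v i j e with z-values v i | z-values v j
  ... | inj₁ z≡0 | _ =
    ≤-respˡ (≡-sym (trans (cong (_* z v j) z≡0) (*-zeroˡ (z v j)))) (0≤ι _)
  ... | inj₂ _ | inj₁ z≡0 =
    ≤-respˡ (≡-sym (trans (cong (z v i *_) z≡0) (*-zeroʳ (z v i)))) (0≤ι _)
  ... | inj₂ (zi≡1 , li) | inj₂ (zj≡1 , lj) with ¾ ≤? f i j
  ... | yes _    = ≤-reflexive (cong₂ _*_ zi≡1 zj≡1)
  ... | no ¾≰f   = ⊥-elim (¾≰f (light-pair⇒heavy v i j e li lj))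

  module _ {q} (τ≥q : τt≥ G q) (x : ℚ) (0≤x : 0ℚ ≤ x) (x≤1 : x ≤ 1ℚ) where

    -- Light neighbours of v lean to one side of the bipartition, all other vertices slightly to the other.
    biased-cut : ∀ v →
      (q + q) + x * weight G (λ i j → z v i + z v j) ≤ κ (edgeCount G) * (1ℚ + x * x) + heavies
    biased-cut v =
      ≤-trans (+-monoˡ-≤ (x * weight G (λ i j → z v i + z v j)) (+-mono-≤ cut cut))
      (≤-respˡ collected (≤-respʳ split (weight-mono G pointwise)))
      where
      p : Fin n → ℚ
      -- Twice the uncut probability of ij is then 1 + (z_i - x)(z_j - x) = 1 + x² - x(z_i + z_j) +
      -- z_i z_j. The linear term is the gain, and the product is paid for by heavy edges.
      p u = (1ℚ + (z v u - x)) * ½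

      0≤p : ∀ u → 0ℚ ≤ p u
      0≤p u = ≤-respʳ (identity (z v u) x)
                (*-nonneg (+-nonneg (0≤z v u) (p≤q⇒0≤q-p x≤1)) (nonNegative⁻¹ ½))
        where
        identity : ∀ z x → (z + (1ℚ - x)) * ½ ≡ (1ℚ + (z - x)) * ½
        identity = solve-∀ ℚ-ring

      p≤1 : ∀ u → p u ≤ 1ℚ
      p≤1 u = 0≤d≡q-p⇒p≤q (*-nonneg (+-nonneg (p≤q⇒0≤q-p (z≤1 v u)) 0≤x) (nonNegative⁻¹ ½))
                (identity (z v u) x)
        where
        identity : ∀ z x → ((1ℚ - z) + x) * ½ ≡ 1ℚ - (1ℚ + (z - x)) * ½
        identity = solve-∀ ℚ-ring

      -- With `A` and `Z` empty, exactly the uncut edges are removed.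
      cut : q ≤ weight G (λ i j → uncut (p i) (p j))
      cut = τt≥⇒≤weight-removalProbability G (λ _ _ → false) (λ _ _ → false) p 0≤p p≤1
              (λ _ _ _ _ _ _ _ → refl , refl , refl) τ≥q

      pointwise : ∀ i j → isEdge G i j ≡ true →
        (uncut (p i) (p j) + uncut (p i) (p j)) + x * (z v i + z v j)
        ≤ (1ℚ + x * x) + ι ⌊ ¾ ≤? f i j ⌋
      pointwise i j e = ≤-respˡ identity
        (+-monoʳ-≤ (1ℚ + x * x) (zz≤heavy v i j e))
        where
        uncut-spread : ∀ s t → uncut ((1ℚ + s) * ½) ((1ℚ + t) * ½) ≡ (1ℚ + s * t) * ½
        uncut-spread = expanded
          where
          expanded : ∀ s t → (1ℚ + s) * ½ * ((1ℚ + t) * ½) +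
            (1ℚ - (1ℚ + s) * ½) * (1ℚ - (1ℚ + t) * ½) ≡ (1ℚ + s * t) * ½
          expanded = solve-∀ ℚ-ring
        expand : ∀ a b x → (1ℚ + x * x) + a * b ≡
          ((1ℚ + (a - x) * (b - x)) * ½ + (1ℚ + (a - x) * (b - x)) * ½) + x * (a + b)
        expand = solve-∀ ℚ-ring
        identity : (1ℚ + x * x) + z v i * z v j ≡
          (uncut (p i) (p j) + uncut (p i) (p j)) + x * (z v i + z v j)
        identity = trans (expand (z v i) (z v j) x)
          (cong (λ u → (u + u) + x * (z v i + z v j)) (≡-sym (uncut-spread (z v i - x) (z v j - x))))

      collected : weight G (λ i j → (uncut (p i) (p j) + uncut (p i) (p j)) + x * (z v i + z v j)) ≡
        (weight G (λ i j → uncut (p i) (p j)) + weight G (λ i j → uncut (p i) (p j)))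
        + x * weight G (λ i j → z v i + z v j)
      collected = trans (weight-+ G (λ i j → uncut (p i) (p j) + uncut (p i) (p j)) (λ i j → x * (z v i + z v j)))
        (cong₂ _+_ (weight-+ G (λ i j → uncut (p i) (p j)) (λ i j → uncut (p i) (p j)))
                   (weight-* G x (λ i j → z v i + z v j)))

      split : weight G (λ i j → (1ℚ + x * x) + ι ⌊ ¾ ≤? f i j ⌋) ≡
        κ (edgeCount G) * (1ℚ + x * x) + heavies
      split = trans (weight-+ G (λ _ _ → 1ℚ + x * x) (λ i j → ι ⌊ ¾ ≤? f i j ⌋))
                    (cong (_+ heavies) (weight-const G (1ℚ + x * x)))

    -- The sum of squares runs over light edges only; since degrees are nonnegative, passing to all
    -- edges can only increase it.
    ∑D²≤weight : ∑ n (λ u → D u * D u) ≤ weight G (λ i j → D i + D j)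
    ∑D²≤weight = ≤-respˡ (≡-sym ∑D²≡) (∑-mono (λ i → ∑-mono (λ j → term i j (isEdge G i j) ⌊ f i j ≤? ⅛ ⌋)))
      where
      0≤D : ∀ u → 0ℚ ≤ D u
      0≤D u = ∑-nonneg (λ v → 0≤z v u)
      term : ∀ i j e l → (if e then ι l else 0ℚ) * (D i + D j) ≤ (if e then D i + D j else 0ℚ)
      term i j true  true  = ≤-reflexive (*-identityˡ (D i + D j))
      term i j true  false = ≤-respˡ (≡-sym (*-zeroˡ (D i + D j))) (+-nonneg (0≤D i) (0≤D j))
      term i j false l     = ≤-reflexive (*-zeroˡ (D i + D j))

    -- Sum `biased-cut` over all `v`. The gains z_i + z_j add up to D_i + D_j on each edge, hence to
    -- at least the sum of squared light degrees, which the tangent bound with parameter `t`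
    -- estimates by the number of light edges.
    averaged-cut : ∀ t →
      κ n * (q + q) + x * (+ 4 / 1 * t * weight G (λ i j → ι ⌊ f i j ≤? ⅛ ⌋) - κ n * (t * t))
      ≤ κ n * (κ (edgeCount G) * (1ℚ + x * x) + heavies)
    averaged-cut t =
      ≤-trans (+-monoʳ-≤ (κ n * (q + q)) (*-monoˡ 0≤x (≤-trans (∑D²-lower t) ∑D²≤weight)))
      (≤-respˡ summed (≤-respʳ (∑-const n _) (∑-mono biased-cut)))
      where
      W : Fin n → ℚ
      W v = weight G (λ i j → z v i + z v j)
      summed : ∑ n (λ v → (q + q) + x * W v) ≡ κ n * (q + q) + x * weight G (λ i j → D i + D j)
      summed =
        trans (∑-+ (λ _ → q + q) (λ v → x * W v))
        (cong₂ _+_ (∑-const n (q + q))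
          (trans (∑-* x W)
            (cong (x *_) (trans (≡-sym (weight-∑ G n (λ v i j → z v i + z v j)))
                                (weight-cong G (λ i j _ → ∑-+ (λ v → z v i) (λ v → z v j)))))))

-- Numerical estimates

-- A positive rational is at least the reciprocal of its own denominator, which serves as `K`.
unit-fraction : ∀ ε → Positive ε → Σ ℕ λ K → Σ ℚ λ r → 0ℚ ≤ r × r ≤ ε × κ K * r ≡ 1ℚ
unit-fraction (mkℚ (+ zero)    d c) record { pos = () }
unit-fraction (mkℚ ℤ.-[1+ a ]  d c) record { pos = () }
unit-fraction (mkℚ (+ suc a)   d c) _ = suc d , r , nonNegative⁻¹ r , r≤ε , inverse
  where
  open ℚᵘ using (mkℚᵘ; *≡*)
  r : ℚ
  r = mkℚ (+ 1) d (1-coprimeTo (suc d))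
  r≤ε : r ≤ mkℚ (+ suc a) d c
  r≤ε = ℚ.*≤* (ℤₚ.*-monoʳ-≤-nonNeg (+ suc d) (ℤ.+≤+ (s≤s (z≤n {a}))))
  inverse : κ (suc d) * r ≡ 1ℚ
  inverse = toℚᵘ-injective (begin
    toℚᵘ (κ (suc d) * r)              ≈⟨ toℚᵘ-homo-* (κ (suc d)) r ⟩
    toℚᵘ (κ (suc d)) ℚᵘ.* toℚᵘ r      ≈⟨ ℚᵘₚ.*-congʳ (toℚᵘ-fromℚᵘ (mkℚᵘ (+ suc d) 0)) ⟩
    mkℚᵘ (+ suc d) 0 ℚᵘ.* mkℚᵘ (+ 1) d ≈⟨ *≡* cross ⟩
    toℚᵘ 1ℚ                           ∎)
    where
    open ℚᵘₚ.≃-Reasoning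
    cross : (+ suc d ℤ.* + 1) ℤ.* + 1 ≡ + 1 ℤ.* + (1 ℕ.* suc d)
    cross = trans (ℤₚ.*-identityʳ (+ suc d ℤ.* + 1))
            (trans (ℤₚ.*-identityʳ (+ suc d))
            (trans (cong +_ (≡-sym (ℕₚ.*-identityˡ (suc d)))) (≡-sym (ℤₚ.*-identityˡ (+ (1 ℕ.* suc d))))))

level≡κ* : ∀ h (0≤h : 0ℚ ≤ h) k → Levels.level h 0≤h k ≡ κ k * h
level≡κ* h 0≤h zero    = ≡-sym (*-zeroˡ h)
level≡κ* h 0≤h (suc k) =
  trans (cong (_+ h) (level≡κ* h 0≤h k)) (trans (factor h (κ k)) (cong (_* h) (≡-sym (κ-suc k))))
  where
  factor : ∀ h k → k * h + h ≡ (1ℚ + k) * h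
  factor = solve-∀ ℚ-ring

-- This crude count yields β ≤ 1 for dense graphs.
edgeCount≤n² : ∀ {n} (G : Graph n) → κ (edgeCount G) ≤ κ n * κ n
edgeCount≤n² {n} G =
  ≤-respˡ (trans (weight-const G 1ℚ) (*-identityʳ (κ (edgeCount G))))
  (≤-respʳ (trans (∑-cong {n} (λ i → trans (∑-const n 1ℚ) (*-identityʳ (κ n)))) (∑-const n (κ n)))
           (∑-mono (λ i → ∑-mono (λ j → term (isEdge G i j)))))
  where
  term : ∀ e → (if e then 1ℚ else 0ℚ) ≤ 1ℚ
  term true  = ≤-refl
  term false = nonNegative⁻¹ 1ℚ

module LevelSums {n} (G : Graph n) {f : Fin n → Fin n → ℚ} (cov : IsFractionalTriangleCover G f)
  {h} (0≤h : 0ℚ ≤ h) (K : ℕ) where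

  open Levels h 0≤h

  private
    m P : ℚ
    m = κ (edgeCount G)
    P = weight G (λ i j → Φ K (f i j))

  module _ (level-K : level K ≡ ⅓) where

    heavy-excess : + 3 / 1 * P + weight G (λ i j → ι ⌊ ¾ ≤? f i j ⌋)
      ≤ + 4 / 1 * weight G f + m * (+ 3 / 1 * h)
    heavy-excess =
      ≤-respˡ (trans (weight-+ G (λ i j → + 3 / 1 * Φ K (f i j)) (λ i j → ι ⌊ ¾ ≤? f i j ⌋))
                     (cong (_+ weight G (λ i j → ι ⌊ ¾ ≤? f i j ⌋))
                           (weight-* G (+ 3 / 1) (λ i j → Φ K (f i j)))))
      (≤-respʳ (trans (weight-+ G (λ i j → + 4 / 1 * f i j) (λ _ _ → + 3 / 1 * h))
                      (cong₂ _+_ (weight-* G (+ 4 / 1) f) (weight-const G (+ 3 / 1 * h))))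
               (weight-mono G (λ i j e → Φ-excess-heavy K level-K (f i j) (proj₁ cov i j e))))

    light-excess : + 18 / 1 * P + m
      ≤ (+ 26 / 1 * weight G f + m * (+ 18 / 1 * h)) + weight G (λ i j → ι ⌊ f i j ≤? ⅛ ⌋)
    light-excess =
      ≤-respˡ (trans (weight-+ G (λ i j → + 18 / 1 * Φ K (f i j)) (λ _ _ → 1ℚ))
                     (cong₂ _+_ (weight-* G (+ 18 / 1) (λ i j → Φ K (f i j)))
                                (trans (weight-const G 1ℚ) (*-identityʳ m))))
      (≤-respʳ (trans (weight-+ G (λ i j → + 26 / 1 * f i j + + 18 / 1 * h) (λ i j → ι ⌊ f i j ≤? ⅛ ⌋))
                      (cong (_+ weight G (λ i j → ι ⌊ f i j ≤? ⅛ ⌋))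
                        (trans (weight-+ G (λ i j → + 26 / 1 * f i j) (λ _ _ → + 18 / 1 * h))
                               (cong₂ _+_ (weight-* G (+ 26 / 1) f) (weight-const G (+ 18 / 1 * h))))))
               (weight-mono G (λ i j e → Φ-excess-light K level-K (f i j) (proj₁ cov i j e))))

-- One quantity plays three roles: δ in the hypothesis, the relative gain in the conclusion, and the
-- bound on the step `h`.
ε[_] : ℚ → ℚ
ε[ β ] = (β * β) * (+ 1 / 800)

hardness : ℚ → ℚ → ℚ
hardness β m = (1ℚ - ε[ β ]) * (m * (+ 1 / 2))

threshold : ℚ → ℚ → ℚ
threshold β m = (1ℚ + ε[ β ]) * (m * (+ 1 / 4))

module Numerics {β m w h P : ℚ} (0≤m : 0ℚ ≤ m) (h≤ε : h ≤ ε[ β ])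
  (w≤ : w ≤ threshold β m) (P≥ : (⅓ + ⅓) * hardness β m ≤ P) where

  -- At ε = 0 both sides of the excess inequality balance at m. The errors are ε from the cover
  -- weight, ε from the hardness and 3ε from the discretisation.
  few-heavy : ∀ {B} → + 3 / 1 * P + B ≤ + 4 / 1 * w + m * (+ 3 / 1 * h) →
    B ≤ + 5 / 1 * ε[ β ] * m
  few-heavy {B} excess =
    0≤d≡q-p⇒p≤q
      (+-nonneg (+-nonneg (p≤q⇒0≤q-p excess) (*-nonneg (nonNegative⁻¹ (+ 4 / 1)) (p≤q⇒0≤q-p w≤)))
                (+-nonneg (*-nonneg (*-nonneg (nonNegative⁻¹ (+ 3 / 1)) 0≤m) (p≤q⇒0≤q-p h≤ε))
                          (*-nonneg (nonNegative⁻¹ (+ 3 / 1)) (p≤q⇒0≤q-p P≥))))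
      (identity ε[ β ] m w h P B)
    where
    identity : ∀ ε m w h P B →
      (((+ 4 / 1 * w + m * (+ 3 / 1 * h)) - (+ 3 / 1 * P + B))
        + + 4 / 1 * ((1ℚ + ε) * (m * (+ 1 / 4)) - w))
      + (+ 3 / 1 * m * (ε - h) + + 3 / 1 * (P - (⅓ + ⅓) * ((1ℚ - ε) * (m * (+ 1 / 2)))))
      ≡ + 5 / 1 * ε * m - B
    identity = solve-∀ ℚ-ring

  -- Without errors this gives 6m + m ≤ 13m/2 + Z, so Z ≥ m/2. The errors are 13/2 + 6 + 18 = 61/2
  -- times εm, at most 61m/1600 because β ≤ 1, and 1/2 - 61/1600 = 2/5 + 99/1600.
  many-light : ∀ {Z} → 0ℚ ≤ β → β ≤ 1ℚ →
    + 18 / 1 * P + m ≤ (+ 26 / 1 * w + m * (+ 18 / 1 * h)) + Z → + 2 / 5 * m ≤ Z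
  many-light {Z} 0≤β β≤1 excess =
    0≤d≡q-p⇒p≤q
      (+-nonneg
        (+-nonneg (+-nonneg (p≤q⇒0≤q-p excess) (*-nonneg (nonNegative⁻¹ (+ 26 / 1)) (p≤q⇒0≤q-p w≤)))
                  (+-nonneg (*-nonneg (*-nonneg (nonNegative⁻¹ (+ 18 / 1)) 0≤m) (p≤q⇒0≤q-p h≤ε))
                            (*-nonneg (nonNegative⁻¹ (+ 18 / 1)) (p≤q⇒0≤q-p P≥))))
        (+-nonneg (*-nonneg (*-nonneg (nonNegative⁻¹ (+ 61 / 1600)) 0≤m)
                    (*-nonneg (p≤q⇒0≤q-p β≤1) (+-nonneg (nonNegative⁻¹ 1ℚ) 0≤β)))
                  (*-nonneg (nonNegative⁻¹ (+ 99 / 1600)) 0≤m)))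
      (trans (cong (λ d → main + (d + + 99 / 1600 * m)) (slack β m)) (identity ε[ β ] m w h P Z))
    where
    main : ℚ
    main = (((+ 26 / 1 * w + m * (+ 18 / 1 * h)) + Z - (+ 18 / 1 * P + m))
        + + 26 / 1 * (threshold β m - w))
      + (+ 18 / 1 * m * (ε[ β ] - h) + + 18 / 1 * (P - (⅓ + ⅓) * hardness β m))
    slack : ∀ β m → + 61 / 1600 * m * ((1ℚ - β) * (1ℚ + β)) ≡
      + 61 / 1600 * m - + 61 / 2 * m * ((β * β) * (+ 1 / 800))
    slack = solve-∀ ℚ-ring
    identity : ∀ ε m w h P Z →
      ((((+ 26 / 1 * w + m * (+ 18 / 1 * h)) + Z - (+ 18 / 1 * P + m))
        + + 26 / 1 * ((1ℚ + ε) * (m * (+ 1 / 4)) - w))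
      + (+ 18 / 1 * m * (ε - h) + + 18 / 1 * (P - (⅓ + ⅓) * ((1ℚ - ε) * (m * (+ 1 / 2))))))
      + ((+ 61 / 1600 * m - + 61 / 2 * m * ε) + + 99 / 1600 * m)
      ≡ Z - + 2 / 5 * m
    identity = solve-∀ ℚ-ring

-- The instance x = β / 4 , t = β n / 2 of LightEdges.averaged-cut.
averaged-cut-impossible : ∀ {β N m B Z} → 0ℚ <ℚ β → 0ℚ <ℚ N → 0ℚ <ℚ m → β * (N * N) ≤ m →
  B ≤ + 5 / 1 * ε[ β ] * m → + 2 / 5 * m ≤ Z →
  N * (hardness β m + hardness β m)
    + β * (+ 1 / 4) * (+ 4 / 1 * (β * ½ * N) * Z - N * (β * ½ * N * (β * ½ * N)))
    ≤ N * (m * (1ℚ + β * (+ 1 / 4) * (β * (+ 1 / 4))) + B) → ⊥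
averaged-cut-impossible {β} {N} {m} {B} {Z} 0<β 0<N 0<m dense B≤ Z≥ cut =
  -- In units of β² N m, the light edges gain 1/5. The losses are 1/16 from x², 1/16 from the
  -- tangent term via β N² ≤ m, and 6/800 from the hardness and the heavy edges, which leaves
  -- 27/400.
  <-irrefl refl (<-≤-trans
    (*-pos (*-pos (*-pos (*-pos (positive⁻¹ (+ 27 / 400)) 0<β) 0<β) 0<N) 0<m)
    (0≤d≡q-p⇒p≤q
      (+-nonneg
        (+-nonneg (p≤q⇒0≤q-p cut) (*-nonneg (<⇒≤ 0<N) (p≤q⇒0≤q-p B≤)))
        (+-nonneg (*-nonneg (*-nonneg (*-nonneg (*-nonneg (nonNegative⁻¹ ½) 0≤β) 0≤β) (<⇒≤ 0<N)) (p≤q⇒0≤q-p Z≥))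
                  (*-nonneg (*-nonneg (*-nonneg (*-nonneg (nonNegative⁻¹ (+ 1 / 16)) 0≤β) 0≤β) (<⇒≤ 0<N)) (p≤q⇒0≤q-p dense))))
      (identity β N m B Z)))
  where
  0≤β = <⇒≤ 0<β
  identity : ∀ β N m B Z →
    ((N * (m * (1ℚ + β * (+ 1 / 4) * (β * (+ 1 / 4))) + B)
      - (N * ((1ℚ - (β * β) * (+ 1 / 800)) * (m * (+ 1 / 2)) + (1ℚ - (β * β) * (+ 1 / 800)) * (m * (+ 1 / 2)))
         + β * (+ 1 / 4) * (+ 4 / 1 * (β * ½ * N) * Z - N * (β * ½ * N * (β * ½ * N)))))
     + N * (+ 5 / 1 * ((β * β) * (+ 1 / 800)) * m - B))
    + (½ * β * β * N * (Z - + 2 / 5 * m) + + 1 / 16 * β * β * N * (m - β * (N * N)))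
    ≡ 0ℚ - + 27 / 400 * β * β * N * m
  identity = solve-∀ ℚ-ring

-- Contradiction from a cheap cover

0<ε[_] : ∀ {β} → 0ℚ <ℚ β → 0ℚ <ℚ ε[ β ]
0<ε[ 0<β ] = *-pos (*-pos 0<β 0<β) (positive⁻¹ (+ 1 / 800))

0<κ : ∀ {n} → 0 < n → 0ℚ <ℚ κ n
0<κ {suc n} _ = positive⁻¹ (κ (suc n)) {{normalize-pos (suc n) 1}}

module CheapCover {β} (0<β : 0ℚ <ℚ β) {n} (0<n : 0 < n) (G : Graph n)
  (dense : β * (κ n * κ n) ≤ κ (edgeCount G)) (hard : τt≥ G (hardness β (κ (edgeCount G))))
  {f} (cov : IsFractionalTriangleCover G f) (cheap : weight G f ≤ threshold β (κ (edgeCount G))) where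

  private
    m : ℚ
    m = κ (edgeCount G)

    0<N² : 0ℚ <ℚ κ n * κ n
    0<N² = *-pos (0<κ 0<n) (0<κ 0<n)

    0<m : 0ℚ <ℚ m
    0<m = <-≤-trans (*-pos 0<β 0<N²) dense

    β≤1 : β ≤ 1ℚ
    β≤1 = *-cancelʳ-≤-pos (κ n * κ n) {{positive 0<N²}}
      (≤-respʳ (≡-sym (*-identityˡ (κ n * κ n))) (≤-trans dense (edgeCount≤n² G)))

  impossible : ∀ K r → 0ℚ ≤ r → r ≤ ε[ β ] → κ K * r ≡ 1ℚ → ⊥
  impossible K r 0≤r r≤ε K*r≡1 =
    averaged-cut-impossible {β} {κ n} {m} {heavies} {lights} 0<β (0<κ 0<n) 0<m dense
      (few-heavy (heavy-excess level-K)) (many-light (<⇒≤ 0<β) β≤1 (light-excess level-K))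
      (LightEdges.averaged-cut G f cov hard (β * (+ 1 / 4))
        (*-nonneg (<⇒≤ 0<β) (nonNegative⁻¹ (+ 1 / 4))) β/4≤1 (β * ½ * κ n))
    where
    h : ℚ
    -- The `K` levels of this step end exactly at 1/3.
    h = r * ⅓

    0≤h : 0ℚ ≤ h
    0≤h = *-nonneg 0≤r (nonNegative⁻¹ ⅓)

    h≤ε : h ≤ ε[ β ]
    h≤ε = ≤-trans (0≤d≡q-p⇒p≤q (*-nonneg (nonNegative⁻¹ (+ 2 / 3)) 0≤r) (gap r)) r≤ε
      where
      gap : ∀ r → + 2 / 3 * r ≡ r - r * ⅓
      gap = solve-∀ ℚ-ring

    β/4≤1 : β * (+ 1 / 4) ≤ 1ℚ
    β/4≤1 = 0≤d≡q-p⇒p≤q (+-nonneg (*-nonneg (nonNegative⁻¹ (+ 1 / 4)) (p≤q⇒0≤q-p β≤1)) (nonNegative⁻¹ ¾)) (gap β)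
      where
      gap : ∀ β → + 1 / 4 * (1ℚ - β) + ¾ ≡ 1ℚ - β * (+ 1 / 4)
      gap = solve-∀ ℚ-ring

    open Levels h 0≤h using (level; Φ; weight-Φ-lower)
    open LevelSums G cov 0≤h K

    level-K : level K ≡ ⅓
    level-K = trans (level≡κ* h 0≤h K)
      (trans (≡-sym (*-assoc (κ K) r ⅓)) (trans (cong (_* ⅓) K*r≡1) (*-identityˡ ⅓)))

    heavies lights : ℚ
    heavies = weight G (λ i j → ι ⌊ ¾ ≤? f i j ⌋)
    lights  = weight G (λ i j → ι ⌊ f i j ≤? ⅛ ⌋)

    P : ℚ
    P = weight G (λ i j → Φ K (f i j))

    open Numerics {β} {m} {weight G f} {h} {P} (<⇒≤ 0<m) h≤ε cheap
      (subst (λ l → (l + l) * hardness β m ≤ P) level-K (weight-Φ-lower G cov hard K))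

theorem2p1 : (β : ℚ) → 0ℚ <ℚ β →
    Σ ℕ λ N → Σ ℚ λ δ → (0ℚ <ℚ δ) ×
    ((n : ℕ) → N < n → (G : Graph n) →
    β * ((+ n / 1) * (+ n / 1)) ≤ (+ edgeCount G / 1) →
    τt≥ G ((1ℚ - δ) * ((+ edgeCount G / 1) * (+ 1 / 2))) →
    τt*≥ G ((1ℚ + (β * β) * (+ 1 / 800)) * ((+ edgeCount G / 1) * (+ 1 / 4))))
-- With N = 0 the size hypothesis says that n is positive, which makes `κ n` and then m positive.
-- The choice of δ is β²/800.
theorem2p1 β 0<β = 0 , ε[ β ] , 0<ε[ 0<β ] , λ n 0<n G dense hard f cov →
  let K , r , 0≤r , r≤ε , K*r≡1 = unit-fraction ε[ β ] (positive 0<ε[ 0<β ]) in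
  [ id
  , (λ cheap → ⊥-elim (CheapCover.impossible 0<β 0<n G dense hard cov (<⇒≤ cheap) K r 0≤r r≤ε K*r≡1))
  ]′ (≤-<-connex (threshold β (κ (edgeCount G))) (weight G f))
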